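{- For every integer $p\ge 0$: if $p\in\{0,1\}$ then $\mathcal{A}(pK_3\cup C_4)<\mathcal{A}((p+1)K_3\cup K_1)$, and if $p\ge 2$ then $\mathcal{A}(pK_3\cup C_4)>\mathcal{A}((p+1)K_3\cup K_1)$.
   Context: Graphs are finite and simple. For a graph $G$ of order $n$ and an integer $k$, $S(G,k)$ denotes the number of partitions of $V(G)$ into exactly $k$ nonempty stable sets (non-equivalent colorings with exactly $k$ colors). Let $\mathcal{B}(G)=\sum_{k=1}^n S(G,k)$, $\mathcal{T}(G)=\sum_{k=1}^n kS(G,k)$, and $\mathcal{A}(G)=\mathcal{T}(G)/\mathcal{B}(G)$. $G\cup H$ denotes disjoint union, $pH$ the disjoint union of $p$ copies of $H$ ($0H$ is the graph with no vertices), $K_m$ the complete graph and $C_m$ the cycle on $m$ vertices. -}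

module Defs where

open import Data.Nat using (ℕ; zero; suc; _+_; _*_; _≡ᵇ_)
open import Data.Nat.DivMod using (_%_)
open import Data.Bool using (Bool; true; false; _∧_; _∨_; not; if_then_else_)
open import Data.Fin using (Fin; toℕ; splitAt; _≟_)
open import Data.Sum using (inj₁; inj₂)
open import Data.List.Base using (List; []; _∷_; [_]; concatMap; length; map; allFin; upTo)
open import Data.Nat.ListAction using (sum)
open import Data.Integer using (+_)
open import Data.Rational using (ℚ; _/_; 0ℚ)
open import Relation.Nullary.Decidable using (⌊_⌋)

-- A finite simple graph on the vertex set Fin n.  The edge relation is
-- given by a Boolean function E; adjacency is its symmetric closure and
-- loops are ignored (adjacency is only ever tested on distinct vertices),
-- so every such structure is a simple graph.
record Graph : Set where
  field
    n : ℕ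
    E : Fin n → Fin n → Bool

open Graph public

adj : (G : Graph) → Fin (n G) → Fin (n G) → Bool
adj G i j = E G i j ∨ E G j i

K : ℕ → Graph
K m = record { n = m ; E = λ i j → not ⌊ i ≟ j ⌋ }

-- Cycle C_m (intended for m ≥ 3): i adjacent to i+1 mod m.
C : ℕ → Graph
C zero    = record { n = zero ; E = λ _ _ → false }
C (suc m) = record { n = suc m ; E = λ i j → toℕ j ≡ᵇ (suc (toℕ i) % suc m) }

emptyG : Graph
emptyG = record { n = zero ; E = λ _ _ → false }

infixr 5 _∪_
_∪_ : Graph → Graph → Graph
G ∪ H = record { n = n G + n H ; E = e }
  where
  e : Fin (n G + n H) → Fin (n G + n H) → Bool
  e i j with splitAt (n G) i | splitAt (n G) j
  ... | inj₁ a | inj₁ b = E G a b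
  ... | inj₂ a | inj₂ b = E H a b
  ... | _      | _      = false

copies : ℕ → Graph → Graph
copies zero    H = emptyG
copies (suc p) H = H ∪ copies p H

-- Set partitions of a list of (distinct) elements, as lists of blocks.
-- Standard recursive enumeration: the first element either forms a new
-- singleton block or is added to exactly one existing block.  Each set
-- partition of the underlying set is produced exactly once.

insertEach : {A : Set} → A → List (List A) → List (List (List A))
insertEach x []       = []
insertEach x (b ∷ bs) = ((x ∷ b) ∷ bs) ∷ map (b ∷_) (insertEach x bs)

partitions : {A : Set} → List A → List (List (List A))
partitions []       = [ [] ]
partitions (x ∷ xs) =
  concatMap (λ P → ([ x ] ∷ P) ∷ insertEach x P) (partitions xs)

allB : {A : Set} → (A → Bool) → List A → Bool
allB p []       = true
allB p (x ∷ xs) = p x ∧ allB p xs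

stable : (G : Graph) → List (Fin (n G)) → Bool
stable G b = allB (λ x → allB (λ y → ⌊ x ≟ y ⌋ ∨ not (adj G x y)) b) b

stablePartitions : (G : Graph) → List (List (List (Fin (n G))))
stablePartitions G = filterB (λ P → allB (stable G) P) (partitions (allFin (n G)))
  where
  filterB : {A : Set} → (A → Bool) → List A → List A
  filterB p []       = []
  filterB p (x ∷ xs) = if p x then x ∷ filterB p xs else filterB p xs

S : Graph → ℕ → ℕ
S G k = length (go (stablePartitions G))
  where
  go : List (List (List (Fin (n G)))) → List (List (List (Fin (n G))))
  go []       = []
  go (P ∷ Ps) = if length P ≡ᵇ k then P ∷ go Ps else go Ps

𝓑 : Graph → ℕ
𝓑 G = sum (map (λ i → S G (suc i)) (upTo (n G)))

𝓣 : Graph → ℕ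
𝓣 G = sum (map (λ i → suc i * S G (suc i)) (upTo (n G)))

-- t / b as a rational number (the value for b = 0 is an arbitrary
-- convention; it never occurs for the graphs in the statement).
ratio : ℕ → ℕ → ℚ
ratio t zero    = 0ℚ
ratio t (suc b) = (+ t) / suc b

𝓐 : Graph → ℚ
𝓐 G = ratio (𝓣 G) (𝓑 G)

{-# OPTIONS --safe #-}
module Submission where

open import Defs
open import Data.Nat using (ℕ; suc; _≤_)
open import Data.Rational using (_<_; _>_)
open import Data.Product using (_×_)
open import Data.Bool using (Bool; true; false; _∧_; _∨_; not; if_then_else_)
open import Data.Bool.Properties using (T-≡; ∨-comm; ∧-zeroʳ)
open import Data.Empty using (⊥-elim)
open import Data.Fin using (Fin; splitAt; _≟_) renaming (zero to fzero; suc to fsuc)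
import Data.Integer as ℤ
import Data.Integer.Properties as ℤ
open import Data.List.Base using (List; []; _∷_; [_]; _++_; concatMap; length; map; allFin; tabulate; upTo)
open import Data.List.Properties
  using (map-∘; map-++; map-tabulate; map-upTo; map-applyUpTo; length-tabulate; length-map)
open import Data.List.Relation.Unary.All as All using (All; []; _∷_)
open import Data.List.Relation.Unary.All.Properties using (concat⁺; map⁺; tabulate⁺)
open import Data.Nat using (zero; pred; _+_; _*_; _∸_; _≡ᵇ_; _≤ᵇ_; z≤n; s≤s) renaming (_<_ to _<ℕ_)
open import Data.Nat.ListAction using (sum)
open import Data.Nat.Properties hiding (_≟_)
open import Data.Nat.Tactic.RingSolver using (solve-∀)
open import Data.Product using (_,_)
import Data.Rational.Properties as ℚ
import Data.Rational.Unnormalised as ℚᵘ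
import Data.Rational.Unnormalised.Properties as ℚᵘ
open import Data.Sum using (inj₁; inj₂)
open import Function using (_∘_; id)
open import Function.Bundles using (module Equivalence)
open import Relation.Binary.PropositionalEquality hiding ([_])
open import Relation.Nullary.Decidable using (⌊_⌋; yes; no)

-- Adding a clique or a 4-cycle disjointly acts on a partition only through its number k
-- of blocks, so 𝓑 and 𝓣 of p K₃ ∪ H are values of a linear functional of functions of k.
-- With Φ f the sum of f k over the stable partitions of p K₃ into k blocks, both averages
-- are quotients Φ u₁ / Φ u₀ (for C₄) and Φ v₁ / Φ v₀ (for K₃ ∪ K₁) of polynomials in k,
-- and their comparison is the sign of a symmetric bilinear form: of the sum over pairs
-- (k, l) of stable partitions of p K₃ of a symmetric polynomial B k l − A k l.  In terms
-- of i and d, this polynomial has only positive coefficients at k = 4 + i, l = 4 + i + d.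
-- For k, l ≥ 3 it is negative only at (3,3), (3,4) and (4,3), and that deficit is
-- absorbed by the terms with 4 in place of 3, as for p ≥ 2 the partitions of p K₃ into 4
-- blocks are no fewer than those into 3.

-- Sums over lists of partitions

𝟙 : Bool → ℕ
𝟙 b = if b then 1 else 0

𝟙-∧ : ∀ a b → 𝟙 (a ∧ b) ≡ 𝟙 a * 𝟙 b
𝟙-∧ true  b = sym (+-identityʳ (𝟙 b))
𝟙-∧ false b = refl

module _ {A : Set} where

  ∑ : (A → ℕ) → List A → ℕ
  ∑ f xs = sum (map f xs)

  ∑-cong : ∀ {f g : A → ℕ} {xs} → All (λ x → f x ≡ g x) xs → ∑ f xs ≡ ∑ g xs
  ∑-cong []         = refl
  ∑-cong (eq ∷ eqs) = cong₂ _+_ eq (∑-cong eqs)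

  ∑-cong-≗ : ∀ {f g : A → ℕ} → f ≗ g → ∑ f ≗ ∑ g
  ∑-cong-≗ f≗g xs = ∑-cong (All.universal f≗g xs)

  ∑-++ : ∀ (f : A → ℕ) xs ys → ∑ f (xs ++ ys) ≡ ∑ f xs + ∑ f ys
  ∑-++ f []       ys = refl
  ∑-++ f (x ∷ xs) ys = trans (cong (f x +_) (∑-++ f xs ys)) (sym (+-assoc (f x) _ _))

  ∑-+ : ∀ (f g : A → ℕ) xs → ∑ (λ x → f x + g x) xs ≡ ∑ f xs + ∑ g xs
  ∑-+ f g []       = refl
  ∑-+ f g (x ∷ xs) rewrite ∑-+ f g xs = lemma (f x) (g x) (∑ f xs) (∑ g xs)
    where
    lemma : ∀ a b c d → (a + b) + (c + d) ≡ (a + c) + (b + d)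
    lemma = solve-∀

  ∑-* : ∀ c (f : A → ℕ) xs → ∑ (λ x → c * f x) xs ≡ c * ∑ f xs
  ∑-* c f []       = sym (*-zeroʳ c)
  ∑-* c f (x ∷ xs) = trans (cong (c * f x +_) (∑-* c f xs)) (sym (*-distribˡ-+ c (f x) _))

module _ {A B : Set} where

  ∑-map : ∀ (f : B → ℕ) (g : A → B) xs → ∑ f (map g xs) ≡ ∑ (f ∘ g) xs
  ∑-map f g xs = cong sum (sym (map-∘ xs))

  ∑-concatMap : ∀ (f : B → ℕ) (g : A → List B) xs → ∑ f (concatMap g xs) ≡ ∑ (∑ f ∘ g) xs
  ∑-concatMap f g []       = refl
  ∑-concatMap f g (x ∷ xs) = trans (∑-++ f (g x) (concatMap g xs)) (cong (∑ f (g x) +_) (∑-concatMap f g xs))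

∑-upTo-suc : ∀ (f : ℕ → ℕ) n → ∑ f (upTo (suc n)) ≡ f 0 + ∑ (f ∘ suc) (upTo n)
∑-upTo-suc f n = cong (λ xs → f 0 + sum xs)
  (trans (map-applyUpTo suc f n) (sym (map-upTo (f ∘ suc) n)))

∑-upTo-𝟙 : ∀ (f : ℕ → ℕ) {m n} → m <ℕ n → ∑ (λ i → f i * 𝟙 (m ≡ᵇ i)) (upTo n) ≡ f m
∑-upTo-𝟙 f {zero} {suc n} _ = begin
  ∑ (λ i → f i * 𝟙 (0 ≡ᵇ i)) (upTo (suc n))
    ≡⟨ ∑-upTo-suc (λ i → f i * 𝟙 (0 ≡ᵇ i)) n ⟩
  f 0 * 1 + ∑ (λ i → f (suc i) * 0) (upTo n)
    ≡⟨ cong (f 0 * 1 +_) (∑-cong-≗ (λ i → *-zeroʳ (f (suc i))) (upTo n)) ⟩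
  f 0 * 1 + ∑ (λ i → 0 * 0) (upTo n)
    ≡⟨ cong₂ _+_ (*-identityʳ (f 0)) (∑-* 0 (λ _ → 0) (upTo n)) ⟩
  f 0 + 0
    ≡⟨ +-identityʳ (f 0) ⟩
  f 0 ∎
  where open ≡-Reasoning
∑-upTo-𝟙 f {suc m} {suc n} (s≤s m<n) = trans (∑-upTo-suc (λ i → f i * 𝟙 (suc m ≡ᵇ i)) n)
  (cong₂ _+_ (*-zeroʳ (f 0)) (∑-upTo-𝟙 (f ∘ suc) m<n))

-- Enumerated partitions: block counts, invariants and relabelling

module _ {A : Set} where

  insertEach-length : ∀ (x : A) P → All (λ Q → length Q ≡ length P × 0 <ℕ length Q) (insertEach x P)
  insertEach-length x []       = []
  insertEach-length x (B ∷ P) = (refl , s≤s z≤n)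
    ∷ map⁺ (All.map (λ (eq , _) → cong suc eq , s≤s z≤n) (insertEach-length x P))

  partitions-length : ∀ (xs : List A) →
    All (λ P → length P ≤ length xs × (0 <ℕ length xs → 0 <ℕ length P)) (partitions xs)
  partitions-length []       = (z≤n , λ ()) ∷ []
  partitions-length (x ∷ xs) = concat⁺ (map⁺ (All.map bounds (partitions-length xs)))
    where
    bounds : ∀ {P} → length P ≤ length xs × (0 <ℕ length xs → 0 <ℕ length P) →
      All (λ Q → length Q ≤ suc (length xs) × (0 <ℕ suc (length xs) → 0 <ℕ length Q))
          (([ x ] ∷ P) ∷ insertEach x P)
    bounds {P} (P≤xs , _) = (s≤s P≤xs , λ _ → s≤s z≤n)
      ∷ All.map (λ (eq , 0<Q) → m≤n⇒m≤1+n (subst (_≤ length xs) (sym eq) P≤xs) , λ _ → 0<Q)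
                (insertEach-length x P)

  module _ {p : A → Set} where

    insertEach-All : ∀ {x P} → p x → All (All p) P → All (All (All p)) (insertEach x P)
    insertEach-All px []         = []
    insertEach-All px (pB ∷ pP) = ((px ∷ pB) ∷ pP) ∷ map⁺ (All.map (pB ∷_) (insertEach-All px pP))

    partitions-All : ∀ {xs} → All p xs → All (All (All p)) (partitions xs)
    partitions-All []         = [] ∷ []
    partitions-All (px ∷ pxs) = concat⁺ (map⁺ (All.map
      (λ pP → ((px ∷ []) ∷ pP) ∷ insertEach-All px pP) (partitions-All pxs)))

  allB-cong : ∀ {p q : A → Bool} {xs} → All (λ x → p x ≡ q x) xs → allB p xs ≡ allB q xs
  allB-cong []         = refl
  allB-cong (eq ∷ eqs) = cong₂ _∧_ eq (allB-cong eqs)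

  allB-∧ : ∀ (p q : A → Bool) xs → allB (λ x → p x ∧ q x) xs ≡ allB p xs ∧ allB q xs
  allB-∧ p q []       = refl
  allB-∧ p q (x ∷ xs) rewrite allB-∧ p q xs with p x | q x
  ... | true  | true  = refl
  ... | true  | false = sym (∧-zeroʳ (allB p xs))
  ... | false | _     = refl

  allB-true : ∀ {p : A → Bool} {xs} → All (λ x → p x ≡ true) xs → allB p xs ≡ true
  allB-true []                      = refl
  allB-true (eq ∷ eqs) rewrite eq = allB-true eqs

module _ {A B : Set} (f : A → B) where

  allB-map : ∀ (p : B → Bool) xs → allB p (map f xs) ≡ allB (p ∘ f) xs
  allB-map p []       = refl
  allB-map p (x ∷ xs) = cong (p (f x) ∧_) (allB-map p xs)

  insertEach-map : ∀ x P → insertEach (f x) (map (map f) P) ≡ map (map (map f)) (insertEach x P)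
  insertEach-map x []      = refl
  insertEach-map x (B ∷ P) = cong₂ _∷_ refl (begin
    map (map f B ∷_) (insertEach (f x) (map (map f) P))       ≡⟨ cong (map (map f B ∷_)) (insertEach-map x P) ⟩
    map (map f B ∷_) (map (map (map f)) (insertEach x P))     ≡⟨ map-∘ (insertEach x P) ⟨
    map (λ Q → map f B ∷ map (map f) Q) (insertEach x P)      ≡⟨ map-∘ (insertEach x P) ⟩
    map (map (map f)) (map (B ∷_) (insertEach x P))           ∎)
    where open ≡-Reasoning

  partitions-map : ∀ xs → partitions (map f xs) ≡ map (map (map f)) (partitions xs)
  partitions-map []       = refl
  partitions-map (x ∷ xs) rewrite partitions-map xs = extend-map (partitions xs)
    where
    extend-map : ∀ Ps → concatMap (λ P → ([ f x ] ∷ P) ∷ insertEach (f x) P) (map (map (map f)) Ps)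
               ≡ map (map (map f)) (concatMap (λ P → ([ x ] ∷ P) ∷ insertEach x P) Ps)
    extend-map []       = refl
    extend-map (P ∷ Ps) = cong₂ _∷_ refl (trans (cong₂ _++_ (insertEach-map x P) (extend-map Ps))
                                              (sym (map-++ (map (map f)) (insertEach x P) _)))

-- Inserting a vertex

-- r is the complement of the adjacency relation, loops included.
module Insertion {A : Set} (r : A → A → Bool)
                 (r-refl : ∀ x → r x x ≡ true) (r-sym : ∀ x y → r x y ≡ r y x) where

  stableB : List A → Bool
  stableB B = allB (λ x → allB (r x) B) B

  stableB-∷ : ∀ x B → stableB (x ∷ B) ≡ allB (r x) B ∧ stableB B
  stableB-∷ x B
    rewrite r-refl x | allB-∧ (λ y → r y x) (λ y → allB (r y) B) B
          | allB-cong (All.universal (λ y → r-sym y x) B)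
    with allB (r x) B
  ... | true  = refl
  ... | false = refl

  stableP : List (List A) → Bool
  stableP P = allB stableB P

  -- When `q` holds exactly outside the clique being inserted, these are the blocks that can still
  -- receive one of its vertices.
  cleanBlocks : (A → Bool) → List (List A) → ℕ
  cleanBlocks q P = ∑ (λ B → 𝟙 (allB q B)) P

  -- The second argument of `G` is needed during an insertion: once a clique vertex has been placed,
  -- the number of clean blocks differs from the number of blocks.
  weight : (A → Bool) → (ℕ → ℕ → ℕ) → List (List A) → ℕ
  weight q G P = 𝟙 (stableP P) * G (length P) (cleanBlocks q P)

  weight-∷ : ∀ q G B Q → weight q G (B ∷ Q)
    ≡ 𝟙 (stableB B) * weight q (λ l c → G (suc l) (𝟙 (allB q B) + c)) Q
  weight-∷ q G B Q =
    trans (cong (_* G (suc (length Q)) (𝟙 (allB q B) + cleanBlocks q Q)) (𝟙-∧ (stableB B) (stableP Q)))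
          (*-assoc (𝟙 (stableB B)) (𝟙 (stableP Q)) _)

  module _ (q : A → Bool) (x : A) (qx : q x ≡ false) where

    -- A stable result arises exactly when `x` joins a clean block, and that block then stops being
    -- clean because `q x` is false. In the induction the head block is absorbed into `G`.
    ∑-insertEach : ∀ G {P} → All (All (λ y → r x y ≡ q y)) P →
      ∑ (weight q G) (insertEach x P)
      ≡ 𝟙 (stableP P) * (cleanBlocks q P * G (length P) (pred (cleanBlocks q P)))
    ∑-insertEach G []                      = refl
    ∑-insertEach G {B ∷ P} (r≡q ∷ r≡qs)
      rewrite qx | stableB-∷ x B | allB-cong r≡q
            | ∑-map (weight q G) (B ∷_) (insertEach x P)
            | ∑-cong-≗ (weight-∷ q G B) (insertEach x P)
            | ∑-* (𝟙 (stableB B)) (weight q (λ l c → G (suc l) (𝟙 (allB q B) + c))) (insertEach x P)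
            | ∑-insertEach (λ l c → G (suc l) (𝟙 (allB q B) + c)) r≡qs
            | 𝟙-∧ (allB q B ∧ stableB B) (stableP P)
            | 𝟙-∧ (allB q B) (stableB B)
            | 𝟙-∧ (stableB B) (stableP P)
      = collect (allB q B) (cleanBlocks q P)
      where
      s t : ℕ
      s = 𝟙 (stableB B)
      t = 𝟙 (stableP P)

      ring₀ : ∀ s t g → 1 * s * t * g + s * (t * 0) ≡ s * t * (1 * g)
      ring₀ = solve-∀

      ring₁ : ∀ s t m g → 1 * s * t * g + s * (t * ((1 + m) * g)) ≡ s * t * ((2 + m) * g)
      ring₁ = solve-∀

      collect : ∀ b m → 𝟙 b * s * t * G (suc (length P)) m
                          + s * (t * (m * G (suc (length P)) (𝟙 b + pred m)))
                      ≡ s * t * ((𝟙 b + m) * G (suc (length P)) (pred (𝟙 b + m)))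
      -- With no clean block in the tail, the default value `pred 0` is harmless: its term carries
      -- the factor 0.
      collect true  zero    = ring₀ s t _
      collect true  (suc m) = ring₁ s t m _
      collect false m       = sym (*-assoc s t _)

    -- Either `x` forms a new block, which is not clean, or it uses up one of the `c` clean blocks.
    step : (ℕ → ℕ → ℕ) → ℕ → ℕ → ℕ
    step G l c = G (1 + l) c + c * G l (pred c)

    ∑-partitions-∷ : ∀ G {xs} → All (λ y → r x y ≡ q y) xs →
      ∑ (weight q G) (partitions (x ∷ xs)) ≡ ∑ (weight q (step G)) (partitions xs)
    ∑-partitions-∷ G {xs} r≡q = trans
      (∑-concatMap (weight q G) (λ P → ([ x ] ∷ P) ∷ insertEach x P) (partitions xs))
      (∑-cong (All.map extend (partitions-All r≡q)))
      where
      extend : ∀ {P} → All (All (λ y → r x y ≡ q y)) P →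
        ∑ (weight q G) (([ x ] ∷ P) ∷ insertEach x P) ≡ weight q (step G) P
      extend {P} r≡qs rewrite ∑-insertEach G r≡qs | stableB-∷ x [] | qx =
        sym (*-distribˡ-+ (𝟙 (stableP P)) _ _)

-- Coefficientwise comparison of polynomials

-- Each carrier is evaluated at fixed but arbitrary natural numbers; a polynomial is
-- the list of its coefficients, constant term first.
record Coefficients : Set₁ where
  field
    Carrier       : Set
    constant      : ℕ → Carrier
    _⊞_ _⊠_       : Carrier → Carrier → Carrier
    _⊑_           : Carrier → Carrier → Bool
    eval          : Carrier → ℕ
    eval-constant : ∀ m → eval (constant m) ≡ m
    eval-⊞        : ∀ a b → eval (a ⊞ b) ≡ eval a + eval b
    eval-⊠        : ∀ a b → eval (a ⊠ b) ≡ eval a * eval b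
    ⊑-sound       : ∀ a b → (a ⊑ b) ≡ true → eval a ≤ eval b

naturals : Coefficients
naturals = record
  { Carrier       = ℕ
  ; constant      = id
  ; _⊞_           = _+_
  ; _⊠_           = _*_
  ; _⊑_           = _≤ᵇ_
  ; eval          = id
  ; eval-constant = λ _ → refl
  ; eval-⊞        = λ _ _ → refl
  ; eval-⊠        = λ _ _ → refl
  ; ⊑-sound       = λ a b a≤b → ≤ᵇ⇒≤ a b (Equivalence.from T-≡ a≤b)
  }

module _ (R : Coefficients) (x : ℕ) where
  open Coefficients R

  private
    Poly : Set
    Poly = List Carrier

    add mul : Poly → Poly → Poly
    add []      q       = q
    add (a ∷ p) []      = a ∷ p
    add (a ∷ p) (b ∷ q) = (a ⊞ b) ∷ add p q
    mul []      q = []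
    mul (a ∷ p) q = add (map (a ⊠_) q) (constant 0 ∷ mul p q)

    leq : Poly → Poly → Bool
    leq []      q       = true
    leq (a ∷ p) []      = (a ⊑ constant 0) ∧ leq p []
    leq (a ∷ p) (b ∷ q) = (a ⊑ b) ∧ leq p q

    ev : Poly → ℕ
    ev []      = 0
    ev (a ∷ p) = eval a + x * ev p

    ev-add : ∀ p q → ev (add p q) ≡ ev p + ev q
    ev-add []      q       = refl
    ev-add (a ∷ p) []      = sym (+-identityʳ _)
    ev-add (a ∷ p) (b ∷ q) rewrite eval-⊞ a b | ev-add p q = lemma (eval a) (eval b) x (ev p) (ev q)
      where
      lemma : ∀ a b x p q → (a + b) + x * (p + q) ≡ (a + x * p) + (b + x * q)
      lemma = solve-∀

    ev-scale : ∀ a q → ev (map (a ⊠_) q) ≡ eval a * ev q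
    ev-scale a []      = sym (*-zeroʳ (eval a))
    ev-scale a (b ∷ q) rewrite eval-⊠ a b | ev-scale a q = lemma (eval a) (eval b) x (ev q)
      where
      lemma : ∀ a b x q → a * b + x * (a * q) ≡ a * (b + x * q)
      lemma = solve-∀

    ev-mul : ∀ p q → ev (mul p q) ≡ ev p * ev q
    ev-mul []      q = refl
    ev-mul (a ∷ p) q
      rewrite ev-add (map (a ⊠_) q) (constant 0 ∷ mul p q) | ev-scale a q
            | eval-constant 0 | ev-mul p q = lemma (eval a) x (ev p) (ev q)
      where
      lemma : ∀ a x p q → a * q + x * (p * q) ≡ (a + x * p) * q
      lemma = solve-∀

    ∧-true : ∀ a {b} → a ∧ b ≡ true → a ≡ true × b ≡ true
    ∧-true true b≡true = refl , b≡true

    leq-sound : ∀ p q → leq p q ≡ true → ev p ≤ ev q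
    leq-sound []      q       _  = z≤n
    leq-sound (a ∷ p) []      le with ∧-true (a ⊑ constant 0) le
    ... | a≤0 , p≤[] = ≤-trans
      (+-mono-≤ (≤-trans (⊑-sound a (constant 0) a≤0) (≤-reflexive (eval-constant 0)))
                (*-monoʳ-≤ x (leq-sound p [] p≤[])))
      (≤-reflexive (*-zeroʳ x))
    leq-sound (a ∷ p) (b ∷ q) le with ∧-true (a ⊑ b) le
    ... | a≤b , p≤q = +-mono-≤ (⊑-sound a b a≤b) (*-monoʳ-≤ x (leq-sound p q p≤q))

  polynomials : Coefficients
  polynomials = record
    { Carrier       = Poly
    ; constant      = λ m → [ constant m ]
    ; _⊞_           = add
    ; _⊠_           = mul
    ; _⊑_           = leq
    ; eval          = ev
    ; eval-constant = λ m → trans (cong₂ _+_ (eval-constant m) (*-zeroʳ x)) (+-identityʳ m)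
    ; eval-⊞        = ev-add
    ; eval-⊠        = ev-mul
    ; ⊑-sound       = leq-sound
    }

-- Reflected polynomials in two variables

infixl 6 _⊕_
infixl 7 _⊗_
data Expr : Set where
  con     : ℕ → Expr
  𝐢 𝐝     : Expr
  _⊕_ _⊗_ : Expr → Expr → Expr

module _ (i d : ℕ) where

  ⟦_⟧ : Expr → ℕ
  ⟦ con m ⟧   = m
  ⟦ 𝐢 ⟧       = i
  ⟦ 𝐝 ⟧       = d
  ⟦ e ⊕ e′ ⟧  = ⟦ e ⟧ + ⟦ e′ ⟧
  ⟦ e ⊗ e′ ⟧  = ⟦ e ⟧ * ⟦ e′ ⟧

  open Coefficients (polynomials (polynomials naturals d) i)

  -- The outer variable is `𝐢`, with coefficients that are polynomials in `𝐝`; hence `𝐝` itself is a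
  -- constant of the outer ring.
  normalise : Expr → Carrier
  normalise (con m)  = constant m
  normalise 𝐢        = [] ∷ [ [ 1 ] ]
  normalise 𝐝        = [ 0 ∷ [ 1 ] ]
  normalise (e ⊕ e′) = normalise e ⊞ normalise e′
  normalise (e ⊗ e′) = normalise e ⊠ normalise e′

  eval-normalise : ∀ e → eval (normalise e) ≡ ⟦ e ⟧
  eval-normalise (con m)  = eval-constant m
  eval-normalise 𝐢        = lemma i d
    where
    lemma : ∀ i d → 0 + i * ((1 + d * 0) + i * 0) ≡ i
    lemma = solve-∀
  eval-normalise 𝐝        = lemma i d
    where
    lemma : ∀ i d → (0 + d * (1 + d * 0)) + i * 0 ≡ d
    lemma = solve-∀
  eval-normalise (e ⊕ e′) = trans (eval-⊞ (normalise e) (normalise e′))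
                                  (cong₂ _+_ (eval-normalise e) (eval-normalise e′))
  eval-normalise (e ⊗ e′) = trans (eval-⊠ (normalise e) (normalise e′))
                                  (cong₂ _*_ (eval-normalise e) (eval-normalise e′))

  -- The added 1 encodes strictness. For concrete expressions the hypothesis holds by `refl` with
  -- `i` and `d` left as variables, since only numeric coefficients are compared.
  ⟦⟧-mono-< : ∀ e e′ → (normalise (con 1 ⊕ e) ⊑ normalise e′) ≡ true → ⟦ e ⟧ <ℕ ⟦ e′ ⟧
  ⟦⟧-mono-< e e′ le = subst₂ _≤_ (eval-normalise (con 1 ⊕ e)) (eval-normalise e′)
    (⊑-sound (normalise (con 1 ⊕ e)) (normalise e′) le)

-- Inserting cliques and 4-cycles into a partition with k blocks

-- Falling factorials; where `pred` truncates, an earlier factor is already 0.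
fall₂ fall₃ fall₄ : ℕ → ℕ
fall₂ k = k * pred k
fall₃ k = fall₂ k * pred (pred k)
fall₄ k = fall₃ k * pred (pred (pred k))

-- X, T, U and V are the duals of adding K₁, K₃, C₄ and K₃ ∪ K₁ disjointly: in
-- T g k the coefficient of g (i + k) counts the stable partitions of K₃ ∪ H with
-- i + k blocks that restrict to a given stable partition of H with k blocks.
X T U V : (ℕ → ℕ) → ℕ → ℕ
X g k = g (1 + k) + k * g k
T g k = g (3 + k) + 3 * k * g (2 + k) + 3 * fall₂ k * g (1 + k) + fall₃ k * g k
U g k = g (4 + k) + (4 * k + 2) * g (3 + k) + (6 * fall₂ k + 6 * k + 1) * g (2 + k)
      + (4 * fall₃ k + 6 * fall₂ k + 2 * k) * g (1 + k)
      + (fall₄ k + 2 * fall₃ k + fall₂ k) * g k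
V g = T (X g)

-- New factors act on `g` first, as when the leading triangle of a disjoint union is removed.
T^ : ℕ → (ℕ → ℕ) → ℕ → ℕ
T^ zero    g = g
T^ (suc p) g = T^ p (T g)

-- Congruence and linearity of the operators

T-cong : ∀ {f g} → f ≗ g → T f ≗ T g
T-cong f≗g k =
  cong₂ _+_ (cong₂ _+_ (cong₂ _+_ (f≗g (3 + k)) (cong (3 * k *_) (f≗g (2 + k))))
                       (cong (3 * fall₂ k *_) (f≗g (1 + k))))
            (cong (fall₃ k *_) (f≗g k))

T^-cong : ∀ p {f g} → f ≗ g → T^ p f ≗ T^ p g
T^-cong zero    f≗g = f≗g
T^-cong (suc p) f≗g = T^-cong p (T-cong f≗g)

T^-commute : (op : (ℕ → ℕ) → ℕ → ℕ) → (∀ g → op (T g) ≗ T (op g)) →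
             ∀ p g → op (T^ p g) ≗ T^ p (op g)
T^-commute op comm zero    g k = refl
T^-commute op comm (suc p) g k =
  trans (T^-commute op comm p (T g) k) (T^-cong p (comm g) k)

T-+ : ∀ f g → T (λ k → f k + g k) ≗ (λ k → T f k + T g k)
T-+ f g k = lemma (3 * k) (3 * fall₂ k) (fall₃ k)
  (f k) (f (1 + k)) (f (2 + k)) (f (3 + k)) (g k) (g (1 + k)) (g (2 + k)) (g (3 + k))
  where
  lemma : ∀ a b c f₀ f₁ f₂ f₃ g₀ g₁ g₂ g₃ →
    (f₃ + g₃) + a * (f₂ + g₂) + b * (f₁ + g₁) + c * (f₀ + g₀)
    ≡ (f₃ + a * f₂ + b * f₁ + c * f₀) + (g₃ + a * g₂ + b * g₁ + c * g₀)
  lemma = solve-∀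

T-* : ∀ m g → T (λ k → m * g k) ≗ (λ k → m * T g k)
T-* m g k = lemma (3 * k) (3 * fall₂ k) (fall₃ k) m (g k) (g (1 + k)) (g (2 + k)) (g (3 + k))
  where
  lemma : ∀ a b c m g₀ g₁ g₂ g₃ → m * g₃ + a * (m * g₂) + b * (m * g₁) + c * (m * g₀)
                                ≡ m * (g₃ + a * g₂ + b * g₁ + c * g₀)
  lemma = solve-∀

T-linear : ∀ a f b g → T (λ k → a * f k + b * g k) ≗ (λ k → a * T f k + b * T g k)
T-linear a f b g k = trans (T-+ (λ k → a * f k) (λ k → b * g k) k) (cong₂ _+_ (T-* a f k) (T-* b g k))

T^-linear : ∀ p a f b g → T^ p (λ k → a * f k + b * g k) ≗ (λ k → a * T^ p f k + b * T^ p g k)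
T^-linear zero    a f b g k = refl
T^-linear (suc p) a f b g k = trans (T^-cong p (T-linear a f b g) k) (T^-linear p a (T f) b (T g) k)

X-linear : ∀ a f b g → X (λ k → a * f k + b * g k) ≗ (λ k → a * X f k + b * X g k)
X-linear a f b g k = lemma a b k (f k) (f (1 + k)) (g k) (g (1 + k))
  where
  lemma : ∀ a b k f₀ f₁ g₀ g₁ → (a * f₁ + b * g₁) + k * (a * f₀ + b * g₀)
                              ≡ a * (f₁ + k * f₀) + b * (g₁ + k * g₀)
  lemma = solve-∀

X-cong : ∀ {f g} → f ≗ g → X f ≗ X g
X-cong f≗g k = cong₂ _+_ (f≗g (1 + k)) (cong (k *_) (f≗g k))

X^ : ℕ → (ℕ → ℕ) → ℕ → ℕ
X^ zero    g = g
X^ (suc m) g = X (X^ m g)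

-- Powers of `X` and falling factorials

k²≡ : ∀ k → k * k ≡ fall₂ k + k
k²≡ zero    = refl
k²≡ (suc k) = lemma k
  where
  lemma : ∀ k → (1 + k) * (1 + k) ≡ (1 + k) * k + (1 + k)
  lemma = solve-∀

k*fall₂≡ : ∀ k → k * fall₂ k ≡ fall₃ k + 2 * fall₂ k
k*fall₂≡ 0             = refl
k*fall₂≡ 1             = refl
k*fall₂≡ (suc (suc k)) = lemma k
  where
  lemma : ∀ k → (2 + k) * ((2 + k) * (1 + k)) ≡ (2 + k) * (1 + k) * k + 2 * ((2 + k) * (1 + k))
  lemma = solve-∀

k*fall₃≡ : ∀ k → k * fall₃ k ≡ fall₄ k + 3 * fall₃ k
k*fall₃≡ 0                   = refl
k*fall₃≡ 1                   = refl
k*fall₃≡ 2                   = refl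
k*fall₃≡ (suc (suc (suc k))) = lemma k
  where
  lemma : ∀ k → (3 + k) * ((3 + k) * (2 + k) * (1 + k))
              ≡ (3 + k) * (2 + k) * (1 + k) * k + 3 * ((3 + k) * (2 + k) * (1 + k))
  lemma = solve-∀

k³≡ : ∀ k → k * (k * k) ≡ fall₃ k + 3 * fall₂ k + k
k³≡ k rewrite k²≡ k | *-distribˡ-+ k (fall₂ k) k | k*fall₂≡ k | k²≡ k = lemma (fall₂ k) (fall₃ k) k
  where
  lemma : ∀ f₂ f₃ k → f₃ + 2 * f₂ + (f₂ + k) ≡ f₃ + 3 * f₂ + k
  lemma = solve-∀

-- The coefficients 1, 6, 7, 1 are Stirling numbers of the second kind.
k⁴≡ : ∀ k → k * (k * (k * k)) ≡ fall₄ k + 6 * fall₃ k + 7 * fall₂ k + k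
k⁴≡ k = begin
  k * (k * (k * k))
    ≡⟨ cong (k *_) (k³≡ k) ⟩
  k * (fall₃ k + 3 * fall₂ k + k)
    ≡⟨ distribute (fall₂ k) (fall₃ k) k ⟩
  k * fall₃ k + 3 * (k * fall₂ k) + k * k
    ≡⟨ cong₂ _+_ (cong₂ _+_ (k*fall₃≡ k) (cong (3 *_) (k*fall₂≡ k))) (k²≡ k) ⟩
  fall₄ k + 3 * fall₃ k + 3 * (fall₃ k + 2 * fall₂ k) + (fall₂ k + k)
    ≡⟨ collect (fall₂ k) (fall₃ k) (fall₄ k) k ⟩
  fall₄ k + 6 * fall₃ k + 7 * fall₂ k + k ∎
  where
  open ≡-Reasoning

  distribute : ∀ f₂ f₃ k → k * (f₃ + 3 * f₂ + k) ≡ k * f₃ + 3 * (k * f₂) + k * k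
  distribute = solve-∀

  collect : ∀ f₂ f₃ f₄ k → f₄ + 3 * f₃ + 3 * (f₃ + 2 * f₂) + (f₂ + k) ≡ f₄ + 6 * f₃ + 7 * f₂ + k
  collect = solve-∀

-- The expansion is first made in powers of `k`, then rewritten in falling factorials, so that later
-- identities can treat these as independent variables.
X²-expand : ∀ g k → X^ 2 g k ≡ g (2 + k) + (2 * k + 1) * g (1 + k) + (fall₂ k + k) * g k
X²-expand g k = trans (lemma k (g k) (g (1 + k)) (g (2 + k)))
  (cong (λ s → g (2 + k) + (2 * k + 1) * g (1 + k) + s * g k) (k²≡ k))
  where
  lemma : ∀ k g₀ g₁ g₂ → (g₂ + (1 + k) * g₁) + k * (g₁ + k * g₀) ≡ g₂ + (2 * k + 1) * g₁ + k * k * g₀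
  lemma = solve-∀

X³-expand : ∀ g k → X^ 3 g k
  ≡ g (3 + k) + (3 * k + 3) * g (2 + k) + (3 * (fall₂ k + k) + 3 * k + 1) * g (1 + k)
    + (fall₃ k + 3 * fall₂ k + k) * g k
X³-expand g k = trans (lemma k (g k) (g (1 + k)) (g (2 + k)) (g (3 + k)))
  (cong₂ (λ s t → g (3 + k) + (3 * k + 3) * g (2 + k) + (3 * s + 3 * k + 1) * g (1 + k) + t * g k)
         (k²≡ k) (k³≡ k))
  where
  lemma : ∀ k g₀ g₁ g₂ g₃ →
    let x₂ = g₃ + (2 + k) * g₂
        x₁ = g₂ + (1 + k) * g₁
        x₀ = g₁ + k * g₀
    in (x₂ + (1 + k) * x₁) + k * (x₁ + k * x₀)
       ≡ g₃ + (3 * k + 3) * g₂ + (3 * (k * k) + 3 * k + 1) * g₁ + k * (k * k) * g₀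
  lemma = solve-∀

X⁴-expand : ∀ g k → X^ 4 g k
  ≡ g (4 + k) + (4 * k + 6) * g (3 + k) + (6 * (fall₂ k + k) + 12 * k + 7) * g (2 + k)
    + (4 * (fall₃ k + 3 * fall₂ k + k) + 6 * (fall₂ k + k) + 4 * k + 1) * g (1 + k)
    + (fall₄ k + 6 * fall₃ k + 7 * fall₂ k + k) * g k
X⁴-expand g k = trans (lemma k (g k) (g (1 + k)) (g (2 + k)) (g (3 + k)) (g (4 + k)))
  (cong₂ _+_ (cong₂ (λ s t → g (4 + k) + (4 * k + 6) * g (3 + k) + (6 * s + 12 * k + 7) * g (2 + k)
                             + (4 * t + 6 * s + 4 * k + 1) * g (1 + k)) (k²≡ k) (k³≡ k))
             (cong (_* g k) (k⁴≡ k)))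
  where
  lemma : ∀ k g₀ g₁ g₂ g₃ g₄ →
    let x₃ = g₄ + (3 + k) * g₃
        x₂ = g₃ + (2 + k) * g₂
        x₁ = g₂ + (1 + k) * g₁
        x₀ = g₁ + k * g₀
        y₂ = x₃ + (2 + k) * x₂
        y₁ = x₂ + (1 + k) * x₁
        y₀ = x₁ + k * x₀
    in (y₂ + (1 + k) * y₁) + k * (y₁ + k * y₀)
       ≡ g₄ + (4 * k + 6) * g₃ + (6 * (k * k) + 12 * k + 7) * g₂
         + (4 * (k * (k * k)) + 6 * (k * k) + 4 * k + 1) * g₁ + k * (k * (k * k)) * g₀
  lemma = solve-∀

-- T is the chromatic polynomial x³ − 3x² + 2x of K₃ evaluated at X.
T-chromatic : ∀ g k → T g k + 3 * X^ 2 g k ≡ 1 * X^ 3 g k + 2 * X^ 1 g k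
T-chromatic g k = trans (cong (λ s → T g k + 3 * s) (X²-expand g k))
  (trans (lemma k (fall₂ k) (fall₃ k) (g k) (g (1 + k)) (g (2 + k)) (g (3 + k)))
         (cong (λ s → 1 * s + 2 * X g k) (sym (X³-expand g k))))
  where
  lemma : ∀ k f₂ f₃ g₀ g₁ g₂ g₃ →
    (g₃ + 3 * k * g₂ + 3 * f₂ * g₁ + f₃ * g₀) + 3 * (g₂ + (2 * k + 1) * g₁ + (f₂ + k) * g₀)
    ≡ 1 * (g₃ + (3 * k + 3) * g₂ + (3 * (f₂ + k) + 3 * k + 1) * g₁ + (f₃ + 3 * f₂ + k) * g₀)
      + 2 * (g₁ + k * g₀)
  lemma = solve-∀

-- U is the chromatic polynomial x⁴ − 4x³ + 6x² − 3x of C₄ evaluated at X.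
U-chromatic : ∀ g k → U g k + (4 * X^ 3 g k + 3 * X^ 1 g k) ≡ 1 * X^ 4 g k + 6 * X^ 2 g k
U-chromatic g k = trans (cong (λ s → U g k + (4 * s + 3 * X g k)) (X³-expand g k))
  (trans (lemma k (fall₂ k) (fall₃ k) (fall₄ k) (g k) (g (1 + k)) (g (2 + k)) (g (3 + k)) (g (4 + k)))
         (cong₂ (λ s t → 1 * s + 6 * t) (sym (X⁴-expand g k)) (sym (X²-expand g k))))
  where
  lemma : ∀ k f₂ f₃ f₄ g₀ g₁ g₂ g₃ g₄ →
    (g₄ + (4 * k + 2) * g₃ + (6 * f₂ + 6 * k + 1) * g₂
      + (4 * f₃ + 6 * f₂ + 2 * k) * g₁ + (f₄ + 2 * f₃ + f₂) * g₀)
    + (4 * (g₃ + (3 * k + 3) * g₂ + (3 * (f₂ + k) + 3 * k + 1) * g₁ + (f₃ + 3 * f₂ + k) * g₀)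
      + 3 * (g₁ + k * g₀))
    ≡ 1 * (g₄ + (4 * k + 6) * g₃ + (6 * (f₂ + k) + 12 * k + 7) * g₂
          + (4 * (f₃ + 3 * f₂ + k) + 6 * (f₂ + k) + 4 * k + 1) * g₁ + (f₄ + 6 * f₃ + 7 * f₂ + k) * g₀)
      + 6 * (g₂ + (2 * k + 1) * g₁ + (f₂ + k) * g₀)
  lemma = solve-∀

-- `T` is a polynomial in `X`. Its negative term, carried through `X`, is `3 * X^ 3 g k`; adding
-- this to both sides avoids subtraction in ℕ.
X-T-commute : ∀ g → X (T g) ≗ T (X g)
X-T-commute g k = +-cancelʳ-≡ (3 * X^ 3 g k) _ _ (begin
  X (T g) k + 3 * X^ 3 g k                  ≡⟨ cong (_+ 3 * X^ 3 g k) (sym (*-identityˡ (X (T g) k))) ⟩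
  1 * X (T g) k + 3 * X^ 3 g k              ≡⟨ X-linear 1 (T g) 3 (X^ 2 g) k ⟨
  X (λ j → 1 * T g j + 3 * X^ 2 g j) k      ≡⟨ X-cong T-chromatic₁ k ⟩
  X (λ j → 1 * X^ 3 g j + 2 * X^ 1 g j) k   ≡⟨ X-linear 1 (X^ 3 g) 2 (X^ 1 g) k ⟩
  1 * X^ 4 g k + 2 * X^ 2 g k               ≡⟨ T-chromatic (X g) k ⟨
  T (X g) k + 3 * X^ 3 g k                  ∎)
  where
  open ≡-Reasoning

  T-chromatic₁ : ∀ j → 1 * T g j + 3 * X^ 2 g j ≡ 1 * X^ 3 g j + 2 * X^ 1 g j
  T-chromatic₁ j = trans (cong (_+ 3 * X^ 2 g j) (*-identityˡ (T g j))) (T-chromatic g j)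

X^-T-commute : ∀ m g → X^ m (T g) ≗ T (X^ m g)
X^-T-commute zero    g k = refl
X^-T-commute (suc m) g k = trans (X-cong (X^-T-commute m g) k) (X-T-commute (X^ m g) k)

X^-combination-T-commute : ∀ a l b m g k →
  a * X^ l (T g) k + b * X^ m (T g) k ≡ T (λ j → a * X^ l g j + b * X^ m g j) k
X^-combination-T-commute a l b m g k = trans
  (cong₂ (λ s t → a * s + b * t) (X^-T-commute l g k) (X^-T-commute m g k))
  (sym (T-linear a (X^ l g) b (X^ m g) k))

-- By `U-chromatic`, `U` is a polynomial in `X`, whose powers commute with `T`; the negative terms
-- are again added to both sides and cancelled.
U-T-commute : ∀ g → U (T g) ≗ T (U g)
U-T-commute g k = +-cancelʳ-≡ (4 * X^ 3 (T g) k + 3 * X^ 1 (T g) k) _ _ (begin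
  U (T g) k + (4 * X^ 3 (T g) k + 3 * X^ 1 (T g) k)      ≡⟨ U-chromatic (T g) k ⟩
  1 * X^ 4 (T g) k + 6 * X^ 2 (T g) k                    ≡⟨ X^-combination-T-commute 1 4 6 2 g k ⟩
  T (λ j → 1 * X^ 4 g j + 6 * X^ 2 g j) k                ≡⟨ T-cong (U-chromatic g) k ⟨
  T (λ j → U g j + (4 * X^ 3 g j + 3 * X^ 1 g j)) k      ≡⟨ T-+ (U g) (λ j → 4 * X^ 3 g j + 3 * X^ 1 g j) k ⟩
  T (U g) k + T (λ j → 4 * X^ 3 g j + 3 * X^ 1 g j) k
    ≡⟨ cong (T (U g) k +_) (X^-combination-T-commute 4 3 3 1 g k) ⟨
  T (U g) k + (4 * X^ 3 (T g) k + 3 * X^ 1 (T g) k)      ∎)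
  where open ≡-Reasoning

-- Comparison of functions from 4 on

-- Φ p is a combination with nonnegative coefficients of evaluations at k ≥ 4 and of
-- f ↦ f 3 + f 4 as soon as p ≥ 2, so it is monotone for ≺.
infix 4 _≺_
record _≺_ (f g : ℕ → ℕ) : Set where
  constructor _,_
  field
    from-4 : ∀ i → f (4 + i) <ℕ g (4 + i)
    at-3-4 : f 3 + f 4 <ℕ g 3 + g 4

-- In `T f 3` the value at 3 has coefficient 6 and the value at 4 has coefficient 18, so six copies
-- of `f 3 + f 4` split off and 12 of `f 4` remain. `T f 4` uses only values from 4 on.
T-mono-≺ : ∀ {f g} → f ≺ g → T f ≺ T g
T-mono-≺ {f} {g} (f<g , f₃₄<g₃₄) = T-< , T₃₄-<
  where
  T-< : ∀ i → T f (4 + i) <ℕ T g (4 + i)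
  T-< i = +-mono-<-≤ (+-mono-<-≤ (+-mono-<-≤ (f<g (3 + i))
      (*-monoʳ-≤ (3 * (4 + i)) (<⇒≤ (f<g (2 + i)))))
      (*-monoʳ-≤ (3 * fall₂ (4 + i)) (<⇒≤ (f<g (1 + i)))))
      (*-monoʳ-≤ (fall₃ (4 + i)) (<⇒≤ (f<g i)))

  regroup : ∀ f₃ f₄ f₅ f₆ t → (f₆ + 9 * f₅ + 18 * f₄ + 6 * f₃) + t
                            ≡ f₆ + 9 * f₅ + 12 * f₄ + 6 * (f₃ + f₄) + t
  regroup = solve-∀

  T₃₄-< : T f 3 + T f 4 <ℕ T g 3 + T g 4
  T₃₄-< = subst₂ _<ℕ_ (sym (regroup (f 3) (f 4) (f 5) (f 6) (T f 4)))
                      (sym (regroup (g 3) (g 4) (g 5) (g 6) (T g 4)))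
    (+-mono-≤-< (+-mono-≤ (+-mono-≤ (+-mono-≤ (<⇒≤ (f<g 2)) (*-monoʳ-≤ 9 (<⇒≤ (f<g 1))))
                          (*-monoʳ-≤ 12 (<⇒≤ (f<g 0))))
                          (*-monoʳ-≤ 6 (<⇒≤ f₃₄<g₃₄)))
                (T-< 0))

T^-mono-≺ : ∀ p {f g} → f ≺ g → T^ p f ≺ T^ p g
T^-mono-≺ zero    f≺g = f≺g
T^-mono-≺ (suc p) f≺g = T^-mono-≺ p (T-mono-≺ f≺g)

-- Two disjoint triangles have 6, 18, 9 and 1 stable partitions into 3, 4, 5 and 6 blocks, so the
-- value at 3 is again dominated by that at 4.
T²-mono-≺ : ∀ {f g} → f ≺ g → T (T f) 0 <ℕ T (T g) 0
T²-mono-≺ {f} {g} (f<g , f₃₄<g₃₄) = subst₂ _<ℕ_ (sym (expand f)) (sym (expand g))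
  (+-mono-<-≤ (+-mono-<-≤ (+-mono-<-≤ (f<g 2) (*-monoʳ-≤ 9 (<⇒≤ (f<g 1))))
                          (*-monoʳ-≤ 12 (<⇒≤ (f<g 0))))
              (*-monoʳ-≤ 6 (<⇒≤ f₃₄<g₃₄)))
  where
  lemma : ∀ f₃ f₄ f₅ f₆ → f₆ + 9 * f₅ + 18 * f₄ + 6 * f₃ + 0 + 0 + 0
                        ≡ f₆ + 9 * f₅ + 12 * f₄ + 6 * (f₃ + f₄)
  lemma = solve-∀

  expand : ∀ f → T (T f) 0 ≡ f 6 + 9 * f 5 + 12 * f 4 + 6 * (f 3 + f 4)
  expand f = lemma (f 3) (f 4) (f 5) (f 6)

Φ : ℕ → (ℕ → ℕ) → ℕ
Φ p f = T^ p f 0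

-- Two of the operators `T` are commuted to the outside: the inner `T^ p` preserves `≺`, and the
-- outer two turn it into an inequality at 0.
Φ-mono-≺ : ∀ p {f g} → f ≺ g → Φ (2 + p) f <ℕ Φ (2 + p) g
Φ-mono-≺ p {f} {g} f≺g = subst₂ _<ℕ_ (T²-commute f) (T²-commute g) (T²-mono-≺ (T^-mono-≺ p f≺g))
  where
  T²-commute : ∀ f → T (T (T^ p f)) 0 ≡ Φ (2 + p) f
  T²-commute f = T^-commute (T ∘ T) (λ _ _ → refl) p f 0

-- The polynomial inequality for large p

one : ℕ → ℕ
one _ = 1

u₀ u₁ v₀ v₁ : ℕ → ℕ
u₀ = U one
u₁ = U id
v₀ = V one
v₁ = V id

-- A and B are the symmetrized tensors v₁ ⊗ u₀ and u₁ ⊗ v₀, so that (Φ p ⊗ Φ p) A and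
-- (Φ p ⊗ Φ p) B are twice the cross products in the comparison of the two ratios.
A B : ℕ → ℕ → ℕ
A k l = v₁ k * u₀ l + u₀ k * v₁ l
B k l = u₁ k * v₀ l + v₀ k * u₁ l

-- Tᴱ, Uᴱ and Xᴱ are T g, U g and X g at 4 + x, where g j stands for the value of the
-- function at j + (4 + x).
Tᴱ Uᴱ : Expr → (ℕ → Expr) → Expr
Tᴱ x g =
  let k₀ = con 4 ⊕ x ; k₁ = con 3 ⊕ x ; k₂ = con 2 ⊕ x
  in g 3 ⊕ con 3 ⊗ k₀ ⊗ g 2 ⊕ con 3 ⊗ (k₀ ⊗ k₁) ⊗ g 1 ⊕ k₀ ⊗ k₁ ⊗ k₂ ⊗ g 0
Uᴱ x g =
  let k₀ = con 4 ⊕ x ; f₂ = k₀ ⊗ (con 3 ⊕ x) ; f₃ = f₂ ⊗ (con 2 ⊕ x) ; f₄ = f₃ ⊗ (con 1 ⊕ x)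
  in g 4 ⊕ (con 4 ⊗ k₀ ⊕ con 2) ⊗ g 3 ⊕ (con 6 ⊗ f₂ ⊕ con 6 ⊗ k₀ ⊕ con 1) ⊗ g 2
     ⊕ (con 4 ⊗ f₃ ⊕ con 6 ⊗ f₂ ⊕ con 2 ⊗ k₀) ⊗ g 1 ⊕ (f₄ ⊕ con 2 ⊗ f₃ ⊕ f₂) ⊗ g 0

Xᴱ : Expr → (ℕ → Expr) → ℕ → Expr
Xᴱ x g j = g (1 + j) ⊕ (con (j + 4) ⊕ x) ⊗ g j

oneᴱ idᴱ : Expr → ℕ → Expr
oneᴱ x j = con 1
idᴱ  x j = con (j + 4) ⊕ x

u₀ᴱ u₁ᴱ v₀ᴱ v₁ᴱ : Expr → Expr
u₀ᴱ x = Uᴱ x (oneᴱ x)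
u₁ᴱ x = Uᴱ x (idᴱ x)
v₀ᴱ x = Tᴱ x (Xᴱ x (oneᴱ x))
v₁ᴱ x = Tᴱ x (Xᴱ x (idᴱ x))

tensorᴱ : Expr → Expr → Expr → Expr → Expr
tensorᴱ a b c d = a ⊗ b ⊕ c ⊗ d

tensor-cong : ∀ {a a′ b b′ c c′ d d′} → a ≡ a′ → b ≡ b′ → c ≡ c′ → d ≡ d′ →
              a * b + c * d ≡ a′ * b′ + c′ * d′
tensor-cong refl refl refl refl = refl

module _ (i d : ℕ) (x : Expr) where

  private
    k : ℕ
    k = 4 + ⟦_⟧ i d x

  -- At `4 + x` every `pred` in the falling factorials computes, so the coefficients agree
  -- definitionally and only the values of `g` need rewriting.
  T-eval : ∀ {g h} → (∀ j → ⟦_⟧ i d (h j) ≡ g (j + k)) → ⟦_⟧ i d (Tᴱ x h) ≡ T g k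
  T-eval {g} {h} eq =
    cong₂ _+_ (cong₂ _+_ (cong₂ _+_ (eq 3) (cong (3 * k *_) (eq 2)))
                         (cong (3 * fall₂ k *_) (eq 1)))
              (cong (fall₃ k *_) (eq 0))

  U-eval : ∀ {g h} → (∀ j → ⟦_⟧ i d (h j) ≡ g (j + k)) → ⟦_⟧ i d (Uᴱ x h) ≡ U g k
  U-eval {g} {h} eq =
    cong₂ _+_ (cong₂ _+_ (cong₂ _+_ (cong₂ _+_ (eq 4) (cong ((4 * k + 2) *_) (eq 3)))
                                    (cong ((6 * fall₂ k + 6 * k + 1) *_) (eq 2)))
                         (cong ((4 * fall₃ k + 6 * fall₂ k + 2 * k) *_) (eq 1)))
              (cong ((fall₄ k + 2 * fall₃ k + fall₂ k) *_) (eq 0))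

  X-eval : ∀ {g h} → (∀ j → ⟦_⟧ i d (h j) ≡ g (j + k)) → ∀ j → ⟦_⟧ i d (Xᴱ x h j) ≡ X g (j + k)
  X-eval eq j = cong₂ _+_ (eq (suc j)) (cong₂ _*_ (+-assoc j 4 _) (eq j))

  u₀-eval : ⟦_⟧ i d (u₀ᴱ x) ≡ u₀ k
  u₀-eval = U-eval {one} {oneᴱ x} (λ _ → refl)

  u₁-eval : ⟦_⟧ i d (u₁ᴱ x) ≡ u₁ k
  u₁-eval = U-eval {id} {idᴱ x} (λ j → +-assoc j 4 _)

  v₀-eval : ⟦_⟧ i d (v₀ᴱ x) ≡ v₀ k
  v₀-eval = T-eval {X one} {Xᴱ x (oneᴱ x)} (X-eval {one} {oneᴱ x} (λ _ → refl))

  v₁-eval : ⟦_⟧ i d (v₁ᴱ x) ≡ v₁ k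
  v₁-eval = T-eval {X id} {Xᴱ x (idᴱ x)} (X-eval {id} {idᴱ x} (λ j → +-assoc j 4 _))

-- After the shift by 4, each coefficient of `1 + A` in `i` and `d` is at most that of `B`; the
-- final `refl` runs this check.
A<B-diagonal : ∀ i d → A (4 + i) (4 + (i + d)) <ℕ B (4 + i) (4 + (i + d))
A<B-diagonal i d = subst₂ _<ℕ_
  (tensor-cong (v₁-eval i d 𝐢) (u₀-eval i d (𝐢 ⊕ 𝐝)) (u₀-eval i d 𝐢) (v₁-eval i d (𝐢 ⊕ 𝐝)))
  (tensor-cong (u₁-eval i d 𝐢) (v₀-eval i d (𝐢 ⊕ 𝐝)) (v₀-eval i d 𝐢) (u₁-eval i d (𝐢 ⊕ 𝐝)))
  (⟦⟧-mono-< i d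
    (tensorᴱ (v₁ᴱ 𝐢) (u₀ᴱ (𝐢 ⊕ 𝐝)) (u₀ᴱ 𝐢) (v₁ᴱ (𝐢 ⊕ 𝐝)))
    (tensorᴱ (u₁ᴱ 𝐢) (v₀ᴱ (𝐢 ⊕ 𝐝)) (v₀ᴱ 𝐢) (u₁ᴱ (𝐢 ⊕ 𝐝)))
    refl)

A-sym : ∀ k l → A k l ≡ A l k
A-sym k l = lemma (u₀ k) (u₀ l) (v₁ k) (v₁ l)
  where
  lemma : ∀ a b c d → c * b + a * d ≡ d * a + b * c
  lemma = solve-∀

B-sym : ∀ k l → B k l ≡ B l k
B-sym k l = lemma (v₀ k) (v₀ l) (u₁ k) (u₁ l)
  where
  lemma : ∀ a b c d → c * b + a * d ≡ d * a + b * c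
  lemma = solve-∀

A<B : ∀ i j → A (4 + i) (4 + j) <ℕ B (4 + i) (4 + j)
A<B i j with ≤-total i j
... | inj₁ i≤j = subst (λ j → A (4 + i) (4 + j) <ℕ B (4 + i) (4 + j)) (m+[n∸m]≡n i≤j)
                   (A<B-diagonal i (j ∸ i))
... | inj₂ j≤i = subst₂ _<ℕ_ (A-sym (4 + j) (4 + i)) (B-sym (4 + j) (4 + i))
                   (subst (λ i → A (4 + j) (4 + i) <ℕ B (4 + j) (4 + i)) (m+[n∸m]≡n j≤i)
                     (A<B-diagonal j (i ∸ j)))

-- At `i = 0` the surplus at (4,4) outweighs the deficit at (3,4). Only one variable occurs, so `d`
-- is set to 0.
A₃₄<B₃₄ : ∀ i → A 3 (4 + i) + A 4 (4 + i) <ℕ B 3 (4 + i) + B 4 (4 + i)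
A₃₄<B₃₄ i = subst₂ _<ℕ_
  (cong₂ _+_ (tensor-cong (refl {x = v₁ 3}) (u₀-eval i 0 𝐢) (refl {x = u₀ 3}) (v₁-eval i 0 𝐢))
             (tensor-cong (refl {x = v₁ 4}) (u₀-eval i 0 𝐢) (refl {x = u₀ 4}) (v₁-eval i 0 𝐢)))
  (cong₂ _+_ (tensor-cong (refl {x = u₁ 3}) (v₀-eval i 0 𝐢) (refl {x = v₀ 3}) (u₁-eval i 0 𝐢))
             (tensor-cong (refl {x = u₁ 4}) (v₀-eval i 0 𝐢) (refl {x = v₀ 4}) (u₁-eval i 0 𝐢)))
  (⟦⟧-mono-< i 0
    (tensorᴱ (con (v₁ 3)) (u₀ᴱ 𝐢) (con (u₀ 3)) (v₁ᴱ 𝐢)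
     ⊕ tensorᴱ (con (v₁ 4)) (u₀ᴱ 𝐢) (con (u₀ 4)) (v₁ᴱ 𝐢))
    (tensorᴱ (con (u₁ 3)) (v₀ᴱ 𝐢) (con (v₀ 3)) (u₁ᴱ 𝐢)
     ⊕ tensorᴱ (con (u₁ 4)) (v₀ᴱ 𝐢) (con (v₀ 4)) (u₁ᴱ 𝐢))
    refl)

A≺B-row : ∀ i → A (4 + i) ≺ B (4 + i)
A≺B-row i = A<B i , subst₂ _<ℕ_ (cong₂ _+_ (A-sym 3 (4 + i)) (A-sym 4 (4 + i)))
                                (cong₂ _+_ (B-sym 3 (4 + i)) (B-sym 4 (4 + i)))
                                (A₃₄<B₃₄ i)

-- Row 3 alone does not compare, but its sum with row 4 does. The factors 1 match the shape of
-- `T^-linear`.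
A≺B-row₃₄ : (λ l → 1 * A 3 l + 1 * A 4 l) ≺ (λ l → 1 * B 3 l + 1 * B 4 l)
A≺B-row₃₄ = (λ i → subst₂ _<ℕ_ (sym (lemma (A 3 (4 + i)) (A 4 (4 + i))))
                              (sym (lemma (B 3 (4 + i)) (B 4 (4 + i)))) (A₃₄<B₃₄ i))
          -- A closed numerical inequality between sums of the four entries with both indices in {3,
          -- 4}.
          , <ᵇ⇒< _ _ _
  where
  lemma : ∀ m n → 1 * m + 1 * n ≡ m + n
  lemma = solve-∀

-- Monotonicity is used twice: in `l` for each row from 4 on and for the sum of rows 3 and 4, then
-- in `k` for the resulting functions. Symmetrization doubles both products, whence the cancelled 2.
cross-product-large : ∀ p → Φ (2 + p) v₁ * Φ (2 + p) u₀ <ℕ Φ (2 + p) u₁ * Φ (2 + p) v₀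
cross-product-large p = *-cancelˡ-< 2 _ _ (subst₂ _<ℕ_ (symmetric v₁ u₀) (symmetric u₁ v₀)
  (Φ-mono-≺ p ΦA≺ΦB))
  where
  Ψ : (ℕ → ℕ) → ℕ
  Ψ = Φ (2 + p)

  double : ∀ m n → n * m + m * n ≡ 2 * (m * n)
  double = solve-∀

  symmetric : ∀ f g → Ψ (λ k → Ψ g * f k + Ψ f * g k) ≡ 2 * (Ψ f * Ψ g)
  symmetric f g = trans (T^-linear (2 + p) (Ψ g) f (Ψ f) g 0) (double (Ψ f) (Ψ g))

  row : ∀ f g k → Ψ (λ l → f k * g l + g k * f l) ≡ Ψ g * f k + Ψ f * g k
  row f g k = trans (T^-linear (2 + p) (f k) g (g k) f 0)
                    (cong₂ _+_ (*-comm (f k) (Ψ g)) (*-comm (g k) (Ψ f)))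

  row₃₄ : ∀ f g → Ψ (λ l → 1 * (f 3 * g l + g 3 * f l) + 1 * (f 4 * g l + g 4 * f l))
                ≡ (Ψ g * f 3 + Ψ f * g 3) + (Ψ g * f 4 + Ψ f * g 4)
  row₃₄ f g = trans (T^-linear (2 + p) 1 (λ l → f 3 * g l + g 3 * f l)
                                        1 (λ l → f 4 * g l + g 4 * f l) 0)
    (cong₂ _+_ (trans (*-identityˡ _) (row f g 3)) (trans (*-identityˡ _) (row f g 4)))

  ΦA≺ΦB : (λ k → Ψ u₀ * v₁ k + Ψ v₁ * u₀ k) ≺ (λ k → Ψ v₀ * u₁ k + Ψ u₁ * v₀ k)
  ΦA≺ΦB = (λ i → subst₂ _<ℕ_ (row v₁ u₀ (4 + i)) (row u₁ v₀ (4 + i)) (Φ-mono-≺ p (A≺B-row i)))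
        , subst₂ _<ℕ_ (row₃₄ v₁ u₀) (row₃₄ u₁ v₀) (Φ-mono-≺ p A≺B-row₃₄)

-- The two cases are 12/4 < 13/4 and 684/154 < 778/175; the second is the negative entry at (3,3),
-- as one triangle has a single stable partition, into 3 blocks.
cross-product-small : ∀ p → p ≤ 1 → Φ p u₁ * Φ p v₀ <ℕ Φ p v₁ * Φ p u₀
cross-product-small 0 _ = <ᵇ⇒< _ _ _
cross-product-small 1 _ = <ᵇ⇒< _ _ _
cross-product-small (suc (suc p)) (s≤s ())

-- Numbers of stable partitions as linear functionals

-- This is the test inside `stable`, so `stableB` of `Insertion` unfolds to `stable G`.
compatible : (G : Graph) → Fin (n G) → Fin (n G) → Bool
compatible G x y = ⌊ x ≟ y ⌋ ∨ not (adj G x y)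

compatible-refl : ∀ G x → compatible G x x ≡ true
compatible-refl G x with x ≟ x
... | yes _  = refl
... | no x≢x = ⊥-elim (x≢x refl)

compatible-sym : ∀ G x y → compatible G x y ≡ compatible G y x
compatible-sym G x y with x ≟ y | y ≟ x
... | yes _   | yes _   = refl
... | yes x≡y | no y≢x  = ⊥-elim (y≢x (sym x≡y))
... | no x≢y  | yes y≡x = ⊥-elim (x≢y (sym y≡x))
... | no _    | no _    = cong not (∨-comm (E G x y) (E G y x))

colorings : Graph → (ℕ → ℕ) → ℕ
colorings G g = ∑ (λ P → 𝟙 (allB (stable G) P) * g (length P)) (partitions (allFin (n G)))

module _ (G : Graph) where

  -- The metavariable is solved by the local function filterB of stablePartitions,
  -- which has no name outside Defs; similarly for S below.
  mutual
    filterStable : List (List (List (Fin (n G)))) → List (List (List (Fin (n G))))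
    filterStable = _

    stablePartitions≡ : stablePartitions G ≡ filterStable (partitions (allFin (n G)))
    stablePartitions≡ with partitions (allFin (n G))
    ... | Ps = refl

  module _ (k : ℕ) where
    mutual
      countLength : List (List (List (Fin (n G)))) → ℕ
      countLength = _

      S≡ : S G k ≡ countLength (stablePartitions G)
      S≡ with stablePartitions G
      ... | Ps = refl

    countLength-filterStable : ∀ Ps → countLength (filterStable Ps)
      ≡ ∑ (λ P → 𝟙 (allB (stable G) P) * 𝟙 (length P ≡ᵇ k)) Ps
    countLength-filterStable []       = refl
    countLength-filterStable (P ∷ Ps) with allB (stable G) P
    ... | false = countLength-filterStable Ps
    ... | true with length P ≡ᵇ k
    ...   | true  = cong suc (countLength-filterStable Ps)
    ...   | false = countLength-filterStable Ps

  -- After exchanging the sums, each stable partition is counted at exactly one index, since its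
  -- number of blocks lies between 1 and `n G`. The lower bound needs a vertex: the partition of the
  -- empty set has no blocks.
  ∑-S : ∀ g → 0 <ℕ n G → ∑ (λ i → g (suc i) * S G (suc i)) (upTo (n G)) ≡ colorings G g
  ∑-S g 0<n = begin
    ∑ (λ i → g (suc i) * S G (suc i)) (upTo (n G))
      ≡⟨ ∑-cong-≗ (λ i → cong (g (suc i) *_) (S-expand (suc i))) (upTo (n G)) ⟩
    ∑ (λ i → g (suc i) * ∑ (λ P → 𝟙 (allB (stable G) P) * 𝟙 (length P ≡ᵇ suc i)) Ps₀) (upTo (n G))
      ≡⟨ exchange (All.map (λ {P} → bounds {P}) (partitions-length (allFin (n G)))) ⟩
    colorings G g ∎
    where
    open ≡-Reasoning

    Ps₀ : List (List (List (Fin (n G))))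
    Ps₀ = partitions (allFin (n G))

    S-expand : ∀ k → S G k ≡ ∑ (λ P → 𝟙 (allB (stable G) P) * 𝟙 (length P ≡ᵇ k)) Ps₀
    S-expand k = trans (S≡ k) (trans (cong (countLength k) stablePartitions≡) (countLength-filterStable k Ps₀))

    bounds : ∀ {P : List (List (Fin (n G)))} →
      length P ≤ length (allFin (n G)) × (0 <ℕ length (allFin (n G)) → 0 <ℕ length P) →
      length P ≤ n G × 0 <ℕ length P
    bounds rewrite length-tabulate {n = n G} id = λ (P≤n , 0<P) → P≤n , 0<P 0<n

    single : ∀ l → l ≤ n G → 0 <ℕ l → ∑ (λ i → g (suc i) * 𝟙 (l ≡ᵇ suc i)) (upTo (n G)) ≡ g l
    single (suc m) m<n _ = ∑-upTo-𝟙 (g ∘ suc) m<n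

    ring₁ : ∀ a s t c → a * (s * t + c) ≡ s * (a * t) + a * c
    ring₁ = solve-∀

    exchange : ∀ {Ps} → All (λ P → length P ≤ n G × 0 <ℕ length P) Ps →
      ∑ (λ i → g (suc i) * ∑ (λ P → 𝟙 (allB (stable G) P) * 𝟙 (length P ≡ᵇ suc i)) Ps) (upTo (n G))
      ≡ ∑ (λ P → 𝟙 (allB (stable G) P) * g (length P)) Ps
    exchange [] = trans (∑-cong-≗ (λ i → *-zeroʳ (g (suc i))) (upTo (n G))) (∑-* 0 (λ _ → 0) (upTo (n G)))
    exchange {P ∷ Ps} ((P≤n , 0<P) ∷ bs) = begin
      ∑ (λ i → g (suc i) * (s * δ i + c i)) (upTo (n G))
        ≡⟨ ∑-cong-≗ (λ i → ring₁ (g (suc i)) s (δ i) (c i)) (upTo (n G)) ⟩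
      ∑ (λ i → s * (g (suc i) * δ i) + g (suc i) * c i) (upTo (n G))
        ≡⟨ ∑-+ (λ i → s * (g (suc i) * δ i)) (λ i → g (suc i) * c i) (upTo (n G)) ⟩
      ∑ (λ i → s * (g (suc i) * δ i)) (upTo (n G)) + ∑ (λ i → g (suc i) * c i) (upTo (n G))
        ≡⟨ cong₂ _+_ (trans (∑-* s (λ i → g (suc i) * δ i) (upTo (n G)))
                            (cong (s *_) (single (length P) P≤n 0<P)))
                     (exchange bs) ⟩
      s * g (length P) + ∑ (λ P → 𝟙 (allB (stable G) P) * g (length P)) Ps ∎
      where
      s : ℕ
      s = 𝟙 (allB (stable G) P)

      δ c : ℕ → ℕ
      δ i = 𝟙 (length P ≡ᵇ suc i)
      c i = ∑ (λ P → 𝟙 (allB (stable G) P) * 𝟙 (length P ≡ᵇ suc i)) Ps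

  𝓣≡colorings : 0 <ℕ n G → 𝓣 G ≡ colorings G id
  𝓣≡colorings = ∑-S id

  𝓑≡colorings : 0 <ℕ n G → 𝓑 G ≡ colorings G one
  𝓑≡colorings 0<n = trans (∑-cong-≗ (λ i → sym (*-identityˡ (S G (suc i)))) (upTo (n G))) (∑-S one 0<n)

-- Removing a triangle from a disjoint union

module _ (p : ℕ) (H : Graph) where

  private
    G₀ G : Graph
    G₀ = copies p (K 3) ∪ H
    G  = copies (suc p) (K 3) ∪ H

    raise₃ : Fin (n G₀) → Fin (n G)
    raise₃ i = fsuc (fsuc (fsuc i))

    q : Fin (n G) → Bool
    q fzero                  = false
    q (fsuc fzero)           = false
    q (fsuc (fsuc fzero))    = false
    q (fsuc (fsuc (fsuc _))) = true

    v₀′ v₁′ v₂′ : Fin (n G)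
    v₀′ = fzero
    v₁′ = fsuc fzero
    v₂′ = fsuc (fsuc fzero)

    compatible-v₀ : ∀ i → compatible G v₀′ (raise₃ i) ≡ true
    compatible-v₀ i with splitAt (n (copies p (K 3))) i
    ... | inj₁ _ = refl
    ... | inj₂ _ = refl

    compatible-v₁ : ∀ i → compatible G v₁′ (raise₃ i) ≡ true
    compatible-v₁ i with splitAt (n (copies p (K 3))) i
    ... | inj₁ _ = refl
    ... | inj₂ _ = refl

    compatible-v₂ : ∀ i → compatible G v₂′ (raise₃ i) ≡ true
    compatible-v₂ i with splitAt (n (copies p (K 3))) i
    ... | inj₁ _ = refl
    ... | inj₂ _ = refl

    E-raise₃ : ∀ i j → E G (raise₃ i) (raise₃ j) ≡ E G₀ i j
    E-raise₃ i j with splitAt (n (copies p (K 3))) i | splitAt (n (copies p (K 3))) j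
    ... | inj₁ _ | inj₁ _ = refl
    ... | inj₁ _ | inj₂ _ = refl
    ... | inj₂ _ | inj₁ _ = refl
    ... | inj₂ _ | inj₂ _ = refl

    compatible-raise₃ : ∀ i j → compatible G (raise₃ i) (raise₃ j) ≡ compatible G₀ i j
    compatible-raise₃ i j rewrite E-raise₃ i j | E-raise₃ j i with i ≟ j
    ... | yes _ = refl
    ... | no _  = refl

    open Insertion (compatible G) (compatible-refl G) (compatible-sym G)

    rest : List (Fin (n G))
    rest = tabulate raise₃

    rest≡q : ∀ x → (∀ i → compatible G x (raise₃ i) ≡ true) →
      All (λ y → compatible G x y ≡ q y) rest
    rest≡q x eq = tabulate⁺ eq

    stable-raise₃ : ∀ B → stable G (map raise₃ B) ≡ stable G₀ B
    stable-raise₃ B = trans (allB-map raise₃ _ B) (allB-cong (All.universal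
      (λ i → trans (allB-map raise₃ _ B) (allB-cong (All.universal (compatible-raise₃ i) B))) B))

    stableP-raise₃ : ∀ P → stableP (map (map raise₃) P) ≡ allB (stable G₀) P
    stableP-raise₃ P = trans (allB-map (map raise₃) stableB P) (allB-cong (All.universal stable-raise₃ P))

    cleanBlocks-raise₃ : ∀ P → cleanBlocks q (map (map raise₃) P) ≡ length P
    cleanBlocks-raise₃ []      = refl
    cleanBlocks-raise₃ (B ∷ P) 
      rewrite trans (allB-map raise₃ q B) (allB-true {xs = B} (All.universal (λ _ → refl) B))
      = cong suc (cleanBlocks-raise₃ P)

    step¹ step² step³ : (ℕ → ℕ) → ℕ → ℕ → ℕ
    step¹ g = step q v₀′ refl (λ l _ → g l)
    step² g = step q v₁′ refl (step¹ g)
    step³ g = step q v₂′ refl (step² g)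

    -- Before any triangle vertex is inserted all blocks are clean, so both arguments equal `l`.
    step³-diagonal : ∀ g l → step³ g l l ≡ T g l
    step³-diagonal g l = lemma l (pred l) (pred (pred l)) (g l) (g (1 + l)) (g (2 + l)) (g (3 + l))
      where
      lemma : ∀ l l′ l″ g₀ g₁ g₂ g₃ →
        (g₃ + l * g₂ + l * (g₂ + l′ * g₁)) + l * ((g₂ + l′ * g₁) + l′ * (g₁ + l″ * g₀))
        ≡ g₃ + 3 * l * g₂ + 3 * (l * l′) * g₁ + l * l′ * l″ * g₀
      lemma = solve-∀

    weight-raise₃ : ∀ g P → weight q (step³ g) (map (map raise₃) P) ≡ 𝟙 (allB (stable G₀) P) * T g (length P)
    weight-raise₃ g P rewrite stableP-raise₃ P | cleanBlocks-raise₃ P | length-map (map raise₃) P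
      = cong (𝟙 (allB (stable G₀) P) *_) (step³-diagonal g (length P))

  -- The triangle's vertices head the vertex list, so `partitions` inserts them last and they can be
  -- peeled off one by one.
  colorings-K₃ : ∀ g → colorings G g ≡ colorings G₀ (T g)
  colorings-K₃ g = begin
    ∑ (weight q (λ l _ → g l)) (partitions (v₀′ ∷ v₁′ ∷ v₂′ ∷ rest))
      ≡⟨ ∑-partitions-∷ q v₀′ refl (λ l _ → g l) (refl ∷ refl ∷ rest≡q v₀′ compatible-v₀) ⟩
    ∑ (weight q (step¹ g)) (partitions (v₁′ ∷ v₂′ ∷ rest))
      ≡⟨ ∑-partitions-∷ q v₁′ refl (step¹ g) (refl ∷ rest≡q v₁′ compatible-v₁) ⟩
    ∑ (weight q (step² g)) (partitions (v₂′ ∷ rest))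
      ≡⟨ ∑-partitions-∷ q v₂′ refl (step² g) (rest≡q v₂′ compatible-v₂) ⟩
    ∑ (weight q (step³ g)) (partitions rest)
      -- What remains is a copy of the vertex set of `G₀`, shifted by three.
      ≡⟨ cong (λ xs → ∑ (weight q (step³ g)) (partitions xs)) (map-tabulate id raise₃) ⟨
    ∑ (weight q (step³ g)) (partitions (map raise₃ (allFin (n G₀))))
      ≡⟨ cong (∑ (weight q (step³ g))) (partitions-map raise₃ (allFin (n G₀))) ⟩
    ∑ (weight q (step³ g)) (map (map (map raise₃)) (partitions (allFin (n G₀))))
      ≡⟨ ∑-map (weight q (step³ g)) (map (map raise₃)) (partitions (allFin (n G₀))) ⟩
    ∑ (λ P → weight q (step³ g) (map (map raise₃) P)) (partitions (allFin (n G₀)))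
      ≡⟨ ∑-cong-≗ (weight-raise₃ g) (partitions (allFin (n G₀))) ⟩
    colorings G₀ (T g) ∎
    where open ≡-Reasoning

colorings-copies : ∀ p H g → colorings (copies p (K 3) ∪ H) g ≡ colorings (emptyG ∪ H) (T^ p g)
colorings-copies zero    H g = refl
colorings-copies (suc p) H g = trans (colorings-K₃ p H g) (colorings-copies p H (T g))

colorings-C₄ : ∀ p g → colorings (copies p (K 3) ∪ C 4) g ≡ Φ p (U g)
colorings-C₄ p g = begin
  colorings (copies p (K 3) ∪ C 4) g   ≡⟨ colorings-copies p (C 4) g ⟩
  -- By evaluation, `C 4` has one stable partition into 4 blocks, two into 3 and one into 2.
  colorings (emptyG ∪ C 4) (T^ p g)    ≡⟨ lemma (T^ p g 2) (T^ p g 3) (T^ p g 4) ⟩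
  U (T^ p g) 0                         ≡⟨ T^-commute U U-T-commute p g 0 ⟩
  Φ p (U g)                            ∎
  where
  open ≡-Reasoning

  lemma : ∀ g₂ g₃ g₄ → 1 * g₄ + (1 * g₃ + (1 * g₃ + (1 * g₂ + 0))) ≡ g₄ + 2 * g₃ + 1 * g₂ + 0 + 0
  lemma = solve-∀

colorings-K₁ : ∀ p g → colorings (copies (suc p) (K 3) ∪ K 1) g ≡ Φ p (V g)
colorings-K₁ p g = begin
  colorings (copies (suc p) (K 3) ∪ K 1) g   ≡⟨ colorings-copies (suc p) (K 1) g ⟩
  colorings (emptyG ∪ K 1) (T^ (suc p) g)    ≡⟨ lemma (T^ (suc p) g 1) ⟩
  -- Of the `suc p` triangles, one is kept inside `V`, so that both graphs are compared through the
  -- same `Φ p`.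
  X (T^ (suc p) g) 0                         ≡⟨ T^-commute X X-T-commute (suc p) g 0 ⟩
  Φ p (V g)                                  ∎
  where
  open ≡-Reasoning

  lemma : ∀ g₁ → 1 * g₁ + 0 ≡ g₁ + 0
  lemma = solve-∀

-- From cross products to averages

ratio-< : ∀ {s b t c} → 0 <ℕ b → 0 <ℕ c → s * c <ℕ t * b → ratio s b < ratio t c
ratio-< {s} {suc b} {t} {suc c} _ _ sc<tb = ℚ.toℚᵘ-cancel-<
  (ℚᵘ.<-respˡ-≃ (ℚᵘ.≃-sym (ℚ.toℚᵘ-fromℚᵘ (ℚᵘ.mkℚᵘ (ℤ.+ s) b)))
  (ℚᵘ.<-respʳ-≃ (ℚᵘ.≃-sym (ℚ.toℚᵘ-fromℚᵘ (ℚᵘ.mkℚᵘ (ℤ.+ t) c)))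
    (ℚᵘ.*<* (subst₂ ℤ._<_ (ℤ.pos-* s (suc c)) (ℤ.pos-* t (suc b)) (ℤ.+<+ sc<tb)))))

-- The term `f (3 + k)` occurs in `T f k` with coefficient 1.
Φ-positive : ∀ p {f} → (∀ k → 0 <ℕ f k) → 0 <ℕ Φ p f
Φ-positive p 0<f = T^-positive p 0<f 0
  where
  T^-positive : ∀ p {f} → (∀ k → 0 <ℕ f k) → ∀ k → 0 <ℕ T^ p f k
  T^-positive zero    0<f = 0<f
  T^-positive (suc p) 0<f = T^-positive p λ k →
    m≤n⇒m≤n+o _ (m≤n⇒m≤n+o _ (m≤n⇒m≤n+o _ (0<f (3 + k))))

module _ (p : ℕ) where

  private
    G H : Graph
    G = copies p (K 3) ∪ C 4
    H = copies (suc p) (K 3) ∪ K 1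

    0<nG : 0 <ℕ n G
    0<nG = ≤-trans (s≤s z≤n) (m≤n+m 4 (n (copies p (K 3))))

  𝓐-C₄ : 𝓐 G ≡ ratio (Φ p u₁) (Φ p u₀)
  𝓐-C₄ = cong₂ ratio (trans (𝓣≡colorings G 0<nG) (colorings-C₄ p id))
                     (trans (𝓑≡colorings G 0<nG) (colorings-C₄ p one))

  𝓐-K₁ : 𝓐 H ≡ ratio (Φ p v₁) (Φ p v₀)
  𝓐-K₁ = cong₂ ratio (trans (𝓣≡colorings H (s≤s z≤n)) (colorings-K₁ p id))
                     (trans (𝓑≡colorings H (s≤s z≤n)) (colorings-K₁ p one))

  Φu₀-positive : 0 <ℕ Φ p u₀
  Φu₀-positive = Φ-positive p (λ _ → s≤s z≤n)

  Φv₀-positive : 0 <ℕ Φ p v₀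
  Φv₀-positive = Φ-positive p (λ _ → s≤s z≤n)

theorem17 : (p : ℕ) →
    (p ≤ 1 → 𝓐 (copies p (K 3) ∪ C 4) < 𝓐 (copies (suc p) (K 3) ∪ K 1)) ×
    (2 ≤ p → 𝓐 (copies p (K 3) ∪ C 4) > 𝓐 (copies (suc p) (K 3) ∪ K 1))
theorem17 p = small , large p
  where
  small : p ≤ 1 → 𝓐 (copies p (K 3) ∪ C 4) < 𝓐 (copies (suc p) (K 3) ∪ K 1)
  small p≤1 = subst₂ _<_ (sym (𝓐-C₄ p)) (sym (𝓐-K₁ p))
    (ratio-< (Φu₀-positive p) (Φv₀-positive p) (cross-product-small p p≤1))

  large : ∀ p → 2 ≤ p → 𝓐 (copies p (K 3) ∪ C 4) > 𝓐 (copies (suc p) (K 3) ∪ K 1)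
  large (suc (suc p)) _ = subst₂ _<_ (sym (𝓐-K₁ (2 + p))) (sym (𝓐-C₄ (2 + p)))
    (ratio-< (Φv₀-positive (2 + p)) (Φu₀-positive (2 + p)) (cross-product-large p))
  large 1 (s≤s ())
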